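{- The triple $(\mathbb{G}, \varepsilon, (\cdot)^*)$ is a comonad in Kleisli form on the category of $\sigma$-structures, i.e. the following equations hold (for all $\sigma$-structures $\mathcal{A}$ and homomorphisms $f : \mathbb{G}\mathcal{A} \to \mathcal{B}$, $g : \mathbb{G}\mathcal{B} \to \mathcal{C}$): \[ \varepsilon_{\mathcal{A}}^* = \mathsf{id}_{\mathbb{G} \mathcal{A}}, \qquad \varepsilon \circ f^* = f, \qquad (g \circ f^*)^* = g^* \circ f^* . \]
   Context: Fix a relational vocabulary $\sigma$ and a notion of guarding $\mathfrak{g}$ (atom, loose, or clique guards). A subset $X$ of a $\sigma$-structure $\mathcal{A}$ is $\mathfrak{g}$-guarded if it is contained in the support of a tuple $\vec{a}$ with $\mathcal{A} \models G(\vec{a})$ for some $\mathfrak{g}$-guard $G$. A play is a non-empty list $p = [U_1,\ldots,U_n]$ of $\mathfrak{g}$-guarded sets of $\mathcal{A}$, with last element $\lambda(p) = U_n$; plays are ordered by the prefix order $\sqsubseteq$. A focussed play is a pair $\langle p, a\rangle$ with $a \in \lambda(p)$. Define $\langle p, a\rangle \sim \langle q, a'\rangle$ iff $a = a'$, the greatest common prefix $p \sqcap q$ is non-empty, and $a$ belongs to $\lambda(u)$ for every $u \in [p\sqcap q, p] \cup [p \sqcap q, q]$. Write $[p,a]$ for the $\sim$-equivalence class of $\langle p, a\rangle$. The structure $\mathbb{G}\mathcal{A}$ (written $\mathbb{G}^{\mathfrak{g}}\mathcal{A}$ when the guard type matters) has universe the set of these classes, and $R^{\mathbb{G}\mathcal{A}}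 = \{([p,a_1],\ldots,[p,a_r]) \mid R^{\mathcal{A}}(a_1,\ldots,a_r)\}$. The counit $\varepsilon_{\mathcal{A}} : \mathbb{G}\mathcal{A} \to \mathcal{A}$ is $\varepsilon_{\mathcal{A}}([p,a]) = a$. For a homomorphism $h : \mathbb{G}\mathcal{A} \to \mathcal{B}$, its coextension $h^* : \mathbb{G}\mathcal{A} \to \mathbb{G}\mathcal{B}$ is $h^*([[U_1,\ldots,U_n],a]) = [[V_1,\ldots,V_n], h([[U_1,\ldots,U_n],a])]$, where $V_j = \{ h([[U_1,\ldots,U_j], b]) \mid b \in U_j\}$ for $1 \le j \le n$. -}

module Defs where

open import Axiom.ExcludedMiddle using (ExcludedMiddle)
open import Data.Bool.Base using (Bool; T)
open import Data.Bool.Properties using (T?)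
open import Data.Empty using (⊥-elim)
open import Data.Fin.Base using (Fin; zero; suc; _↑ˡ_; splitAt)
open import Data.List.Base using (List; []; _∷_)
open import Data.List.Relation.Unary.All as All using (All; []; _∷_)
open import Data.List.Relation.Unary.Any using (Any; here)
open import Data.Nat.Base as ℕ using (ℕ; _+_)
import Data.Nat.Properties as ℕₚ
open import Data.Product.Base using (Σ-syntax; ∃-syntax; _×_; _,_; proj₁; proj₂)
open import Data.Sum.Base using (_⊎_; inj₁; inj₂; [_,_]′)
open import Data.Vec.Functional using (Vector; _++_)
open import Data.Vec.Functional.Properties using (lookup-++ˡ)
open import Function.Base using (_∘_; id)
open import Function.Bundles using (Func; _⟶ₛ_; _⇔_; mk⇔; Equivalence)
import Function.Construct.Composition as Composition
import Function.Construct.Identity as Identity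
open import Level as Level using (Level)
open import Relation.Binary.Bundles using (Setoid)
open import Relation.Binary.PropositionalEquality using (_≡_; refl)
open import Relation.Nullary.Decidable using (Dec; yes; no; ⌊_⌋; toWitness; fromWitness)
open import Relation.Nullary.Negation using (¬_)

record Vocabulary (ℓ : Level) : Set (Level.suc ℓ) where
  field
    Symbol : Set ℓ
    arity  : Symbol → ℕ

-- Universes are setoids, because the universe of 𝔾 A is a quotient.

record Structure {ℓ : Level} (σ : Vocabulary ℓ) : Set (Level.suc ℓ) where
  open Vocabulary σ
  field
    universe : Setoid ℓ ℓ
  open Setoid universe public
    using (Carrier; _≈_; isEquivalence)
    renaming (refl to ≈-refl; sym to ≈-sym; trans to ≈-trans)
  field
    rel      : (R : Symbol) → Vector Carrier (arity R) → Set ℓ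
    rel-resp : ∀ R {as bs : Vector Carrier (arity R)} →
               (∀ i → as i ≈ bs i) → rel R as → rel R bs

module _ {ℓ : Level} {σ : Vocabulary ℓ} where
  open Vocabulary σ

  record Hom (A B : Structure σ) : Set ℓ where
    private
      module A = Structure A
      module B = Structure B
    field
      func : A.universe ⟶ₛ B.universe
    open Func func public using () renaming (to to apply; cong to apply-cong)
    field
      preserves : ∀ R (as : Vector A.Carrier (arity R)) →
                  A.rel R as → B.rel R (apply ∘ as)

  infix 4 _≋_
  _≋_ : {A B : Structure σ} → Hom A B → Hom A B → Set ℓ
  _≋_ {A} {B} f g = ∀ (x : Carrier A) → _≈_ B (Hom.apply f x) (Hom.apply g x)
    where open Structure

  idₕ : (A : Structure σ) → Hom A A
  idₕ A = record
    { func      = Identity.function (Structure.universe A)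
    ; preserves = λ R as r → r
    }

  infixr 9 _∘ₕ_
  _∘ₕ_ : {A B C : Structure σ} → Hom B C → Hom A B → Hom A C
  g ∘ₕ f = record
    { func      = Composition.function (Hom.func f) (Hom.func g)
    ; preserves = λ R as r → Hom.preserves g R _ (Hom.preserves f R as r)
    }

data Guarding : Set where
  atom loose clique : Guarding

module _ {ℓ : Level} (σ : Vocabulary ℓ) where
  open Vocabulary σ

  -- Atomic formulas of first-order logic with equality, over n variables.
  -- With the guard x = x, every singleton is guarded.

  data Atom (n : ℕ) : Set ℓ where
    rel : (R : Symbol) → Vector (Fin n) (arity R) → Atom n
    eq  : Fin n → Fin n → Atom n

module _ {ℓ : Level} {σ : Vocabulary ℓ} where
  open Vocabulary σ

  positions : ∀ {n} → Atom σ n → ℕ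
  positions (rel R v) = arity R
  positions (eq u w)  = 2

  variableAt : ∀ {n} (α : Atom σ n) → Vector (Fin n) (positions α)
  variableAt (rel R v) j          = v j
  variableAt (eq u w)  zero       = u
  variableAt (eq u w)  (suc zero) = w

  infix 4 _occursIn_
  _occursIn_ : ∀ {n} → Fin n → Atom σ n → Set
  i occursIn α = ∃[ j ] variableAt α j ≡ i

  infix 4 _⊨_[_]
  _⊨_[_] : (A : Structure σ) → ∀ {n} → Atom σ n → Vector (Structure.Carrier A) n → Set ℓ
  A ⊨ rel R v [ a ] = Structure.rel A R (a ∘ v)
  A ⊨ eq u w  [ a ] = Structure._≈_ A (a u) (a w)

-- Guards G(x⃗) whose free variables are exactly the n variables x⃗:
--   atom    an atomic formula;
--   loose   a conjunction of atomic formulas in which any two variables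
--           co-occur in some conjunct;
--   clique  a conjunction of formulas ∃z⃗. α(x⃗, z⃗), with α atomic, in which
--           any two of the x⃗ co-occur in some conjunct.
-- Taking i = j in the co-occurrence conditions, every variable occurs.

Guard : ∀ {ℓ} (σ : Vocabulary ℓ) → Guarding → ℕ → Set ℓ
Guard σ atom n =
  Σ[ α ∈ Atom σ n ] ∀ i → i occursIn α
Guard σ loose n =
  Σ[ αs ∈ List (Atom σ n) ]
    ∀ i j → Any (λ α → i occursIn α × j occursIn α) αs
Guard σ clique n =
  Σ[ γs ∈ List (∃[ k ] Atom σ (n + k)) ]
    ∀ i j → Any (λ (k , α) → i ↑ˡ k occursIn α × j ↑ˡ k occursIn α) γs

Satisfies : ∀ {ℓ} {σ : Vocabulary ℓ} (A : Structure σ) (𝔤 : Guarding) {n : ℕ} →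
            Guard σ 𝔤 n → Vector (Structure.Carrier A) n → Set ℓ
Satisfies A atom   (α , _)  a = A ⊨ α [ a ]
Satisfies A loose  (αs , _) a = All (λ α → A ⊨ α [ a ]) αs
Satisfies A clique (γs , _) a =
  All (λ (k , α) → Σ[ z ∈ Vector (Structure.Carrier A) k ] A ⊨ α [ a ++ z ]) γs

-- A subset is a characteristic function. As excluded middle is assumed below,
-- these are all the subsets, and they live in the universe of the structure.

record Subset {ℓ : Level} {σ : Vocabulary ℓ} (A : Structure σ) : Set ℓ where
  open Structure A
  field
    member      : Carrier → Bool
    member-resp : ∀ {x y} → x ≈ y → T (member x) → T (member y)

module _ {ℓ : Level} {σ : Vocabulary ℓ} {A : Structure σ} where
  open Structure A

  infix 4 _∈_ _≐_

  _∈_ : Carrier → Subset A → Set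
  x ∈ U = T (Subset.member U x)

  _≐_ : Subset A → Subset A → Set ℓ
  U ≐ V = ∀ x → x ∈ U ⇔ x ∈ V

  ≐-refl : ∀ U → U ≐ U
  ≐-refl U x = mk⇔ id id

  ≐-sym : ∀ U V → U ≐ V → V ≐ U
  ≐-sym U V e x = mk⇔ (Equivalence.from (e x)) (Equivalence.to (e x))

  ≐-trans : ∀ U V W → U ≐ V → V ≐ W → U ≐ W
  ≐-trans U V W e e′ x = mk⇔ (Equivalence.to (e′ x) ∘ Equivalence.to (e x))
                             (Equivalence.from (e x) ∘ Equivalence.from (e′ x))

-- Excluded middle provides the greatest common prefixes that make ∼ transitive,
-- and the characteristic function of the image of a subset.

module GuardedComonad {ℓ : Level} (em : ExcludedMiddle ℓ)
                      (σ : Vocabulary ℓ) (𝔤 : Guarding) where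

  open Structure using (Carrier)

  IsGuarded : (A : Structure σ) → Subset A → Set ℓ
  IsGuarded A U =
    ∃[ n ] Σ[ G ∈ Guard σ 𝔤 n ] Σ[ a ∈ Vector (Carrier A) n ]
      Satisfies A 𝔤 G a × (∀ x → x ∈ U → ∃[ i ] Structure._≈_ A x (a i))

  record GuardedSet (A : Structure σ) : Set ℓ where
    constructor _,_
    field
      set     : Subset A
      guarded : IsGuarded A set

  open GuardedSet using (set; guarded)

  -- Non-empty lists of guarded sets; p ▷ U is p with U appended at the end.

  infixl 6 _▷_
  data Play (A : Structure σ) : Set ℓ where
    [_] : GuardedSet A → Play A
    _▷_ : Play A → GuardedSet A → Play A

  last : {A : Structure σ} → Play A → Subset A
  last [ U ]   = set U
  last (p ▷ U) = set U

  infix 4 _≈ₚ_ _⊑_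

  data _≈ₚ_ {A : Structure σ} : Play A → Play A → Set ℓ where
    [_] : ∀ {U V} → set U ≐ set V → [ U ] ≈ₚ [ V ]
    _▷_ : ∀ {p q U V} → p ≈ₚ q → set U ≐ set V → p ▷ U ≈ₚ q ▷ V

  data _⊑_ {A : Structure σ} : Play A → Play A → Set ℓ where
    equal  : ∀ {p q} → p ≈ₚ q → p ⊑ q
    append : ∀ {p q U} → p ⊑ q → p ⊑ q ▷ U

  record _IsGCPof_,_ {A : Structure σ} (m p q : Play A) : Set ℓ where
    field
      prefixˡ  : m ⊑ p
      prefixʳ  : m ⊑ q
      greatest : ∀ n → n ⊑ p → n ⊑ q → n ⊑ m

  record FocussedPlay (A : Structure σ) : Set ℓ where
    constructor ⟨_,_,_⟩
    field
      play   : Play A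
      focus  : Carrier A
      focus∈ : focus ∈ last play

  -- Plays being non-empty, the greatest common prefix of two plays (as lists)
  -- is non-empty iff they have a greatest common prefix in Play A.

  infix 4 _∼_
  record _∼_ {A : Structure σ} (x y : FocussedPlay A) : Set ℓ where
    open FocussedPlay x renaming (play to p; focus to a)
    open FocussedPlay y renaming (play to q; focus to a′)
    field
      focus-≈ : Structure._≈_ A a a′
      p⊓q     : Play A
      isGCP   : p⊓q IsGCPof p , q
      within  : ∀ u → p⊓q ⊑ u → u ⊑ p ⊎ u ⊑ q → a ∈ last u

  module _ {A : Structure σ} where
    open Structure A using (_≈_; ≈-refl; ≈-sym; ≈-trans)

    ≈ₚ-refl : (p : Play A) → p ≈ₚ p
    ≈ₚ-refl [ U ]   = [ ≐-refl (set U) ]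
    ≈ₚ-refl (p ▷ U) = ≈ₚ-refl p ▷ ≐-refl (set U)

    ≈ₚ-sym : {p q : Play A} → p ≈ₚ q → q ≈ₚ p
    ≈ₚ-sym ([_] {U} {V} e)         = [ ≐-sym (set U) (set V) e ]
    ≈ₚ-sym (_▷_ {U = U} {V = V} d e) = ≈ₚ-sym d ▷ ≐-sym (set U) (set V) e

    ≈ₚ-trans : {p q r : Play A} → p ≈ₚ q → q ≈ₚ r → p ≈ₚ r
    ≈ₚ-trans ([_] {U} {V} e) ([_] {V = W} e′) =
      [ ≐-trans (set U) (set V) (set W) e e′ ]
    ≈ₚ-trans (_▷_ {U = U} {V = V} d e) (_▷_ {V = W} d′ e′) =
      ≈ₚ-trans d d′ ▷ ≐-trans (set U) (set V) (set W) e e′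

    last-cong : {p q : Play A} → p ≈ₚ q → last p ≐ last q
    last-cong [ e ]   = e
    last-cong (d ▷ e) = e

    last-to : ∀ {p q : Play A} x → p ≈ₚ q → x ∈ last p → x ∈ last q
    last-to x e = Equivalence.to (last-cong e x)

    ⊑-refl : (p : Play A) → p ⊑ p
    ⊑-refl p = equal (≈ₚ-refl p)

    ⊑-≈ₚ : {p q r : Play A} → p ⊑ q → q ≈ₚ r → p ⊑ r
    ⊑-≈ₚ (equal d)  e       = equal (≈ₚ-trans d e)
    ⊑-≈ₚ (append s) (e ▷ _) = append (⊑-≈ₚ s e)

    ⊑-trans : {p q r : Play A} → p ⊑ q → q ⊑ r → p ⊑ r
    ⊑-trans s (equal e)  = ⊑-≈ₚ s e
    ⊑-trans s (append t) = append (⊑-trans s t)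

    private
      length : Play A → ℕ
      length [ U ]   = 0
      length (p ▷ U) = ℕ.suc (length p)

      length-cong : {p q : Play A} → p ≈ₚ q → length p ℕ.≤ length q
      length-cong [ _ ]   = ℕ.z≤n
      length-cong (d ▷ _) = ℕ.s≤s (length-cong d)

      length-mono : {p q : Play A} → p ⊑ q → length p ℕ.≤ length q
      length-mono (equal e)  = length-cong e
      length-mono (append s) = ℕₚ.m≤n⇒m≤1+n (length-mono s)

    ⊑-antisym : {p q : Play A} → p ⊑ q → q ⊑ p → p ≈ₚ q
    ⊑-antisym (equal e)  t = e
    ⊑-antisym (append s) t =
      ⊥-elim (ℕₚ.<-irrefl refl (ℕₚ.≤-trans (length-mono t) (length-mono s)))

    comparable : {p q r : Play A} → p ⊑ r → q ⊑ r → p ⊑ q ⊎ q ⊑ p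
    comparable (equal e)  t          = inj₂ (⊑-≈ₚ t (≈ₚ-sym e))
    comparable (append s) (equal e)  = inj₁ (⊑-≈ₚ (append s) (≈ₚ-sym e))
    comparable (append s) (append t) = comparable s t

    -- Classically, it is enough to give some common prefix in place of the
    -- greatest one.

    gcp-exists : (p q : Play A) {c : Play A} → c ⊑ p → c ⊑ q →
                 ∃[ m ] m IsGCPof p , q
    gcp-exists p q s t with em {p ⊑ q}
    gcp-exists p q s t | yes p⊑q =
      p , record { prefixˡ = ⊑-refl p ; prefixʳ = p⊑q ; greatest = λ _ n⊑p _ → n⊑p }
    gcp-exists p q (equal e) t | no p⋢q =
      ⊥-elim (p⋢q (⊑-trans (equal (≈ₚ-sym e)) t))
    gcp-exists (p ▷ U) q (append s) t | no p⋢q with gcp-exists p q s t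
    ... | m , isGCP = m , record
      { prefixˡ  = append prefixˡ
      ; prefixʳ  = prefixʳ
      ; greatest = λ where
          n (equal e)  n⊑q → ⊥-elim (p⋢q (⊑-trans (equal (≈ₚ-sym e)) n⊑q))
          n (append r) n⊑q → greatest n r n⊑q
      }
      where open _IsGCPof_,_ isGCP

    module _ {x y : FocussedPlay A} where
      open FocussedPlay x renaming (play to p; focus to a)
      open FocussedPlay y renaming (play to q; focus to a′)

      common-prefix⇒∼ : a ≈ a′ → (c : Play A) → c ⊑ p → c ⊑ q →
                        (∀ u → c ⊑ u → u ⊑ p ⊎ u ⊑ q → a ∈ last u) → x ∼ y
      common-prefix⇒∼ a≈a′ c s t w with gcp-exists p q s t
      ... | m , isGCP = record
        { focus-≈ = a≈a′
        ; p⊓q     = m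
        ; isGCP   = isGCP
        ; within  = λ u m⊑u → w u (⊑-trans (_IsGCPof_,_.greatest isGCP c s t) m⊑u)
        }

      ≈ₚ⇒∼ : p ≈ₚ q → a ≈ a′ → x ∼ y
      ≈ₚ⇒∼ e a≈a′ = common-prefix⇒∼ a≈a′ p (⊑-refl p) (equal e) λ where
        u s (inj₁ t) → last-to a (⊑-antisym s t) (FocussedPlay.focus∈ x)
        u s (inj₂ t) → last-to a (⊑-antisym s (⊑-≈ₚ t (≈ₚ-sym e))) (FocussedPlay.focus∈ x)

    ∼-sym : {x y : FocussedPlay A} → x ∼ y → y ∼ x
    ∼-sym e = common-prefix⇒∼ (≈-sym focus-≈) p⊓q prefixʳ prefixˡ
      λ u s t → Subset.member-resp (last u) focus-≈
                  (within u s ([ inj₂ , inj₁ ]′ t))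
      where
      open _∼_ e
      open _IsGCPof_,_ isGCP

    ∼-refl : (x : FocussedPlay A) → x ∼ x
    ∼-refl x = ≈ₚ⇒∼ (≈ₚ-refl _) ≈-refl

    ∼-trans : {x y z : FocussedPlay A} → x ∼ y → y ∼ z → x ∼ z
    ∼-trans {x} {y} {z} d e =
      [ (λ s → common-prefix⇒∼ a≈a″ d.p⊓q d.prefixˡ (⊑-trans s e.prefixʳ) λ where
          u t (inj₁ u⊑p) → d.within u t (inj₁ u⊑p)
          u t (inj₂ u⊑r) → [ (λ v → d.within u t (inj₂ (⊑-trans v e.prefixˡ)))
                           , (λ v → back u (e.within u v (inj₂ u⊑r)))
                           ]′ (comparable u⊑r e.prefixʳ))
      , (λ s → common-prefix⇒∼ a≈a″ e.p⊓q (⊑-trans s d.prefixˡ) e.prefixʳ λ where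
          u t (inj₂ u⊑r) → back u (e.within u t (inj₂ u⊑r))
          u t (inj₁ u⊑p) → [ (λ v → back u (e.within u t (inj₁ (⊑-trans v d.prefixʳ))))
                           , (λ v → d.within u v (inj₁ u⊑p))
                           ]′ (comparable u⊑p d.prefixˡ))
      ]′ (comparable d.prefixʳ e.prefixˡ)
      where
      module d where
        open _∼_ d public
        open _IsGCPof_,_ isGCP public
      module e where
        open _∼_ e public
        open _IsGCPof_,_ isGCP public
      a≈a″ : FocussedPlay.focus x ≈ FocussedPlay.focus z
      a≈a″ = ≈-trans d.focus-≈ e.focus-≈
      back : ∀ u → FocussedPlay.focus y ∈ last u → FocussedPlay.focus x ∈ last u
      back u = Subset.member-resp (last u) (≈-sym d.focus-≈)

  𝔾 : Structure σ → Structure σ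
  𝔾 A = record
    { universe = record
        { Carrier       = FocussedPlay A
        ; _≈_           = _∼_
        ; isEquivalence = record
            { refl = λ {x} → ∼-refl x ; sym = ∼-sym ; trans = ∼-trans }
        }
    ; rel = λ R xs →
        Σ[ p ∈ Play A ] Σ[ as ∈ Vector (Carrier A) (arity R) ]
        Σ[ as∈ ∈ (∀ i → as i ∈ last p) ]
          (Structure.rel A R as × (∀ i → xs i ∼ ⟨ p , as i , as∈ i ⟩))
    ; rel-resp = λ R xs∼ys (p , as , as∈ , r , e) →
        p , as , as∈ , r , λ i → ∼-trans (∼-sym (xs∼ys i)) (e i)
    }
    where open Vocabulary σ

  ε : (A : Structure σ) → Hom (𝔾 A) A
  ε A = record
    { func      = record { to = FocussedPlay.focus ; cong = _∼_.focus-≈ }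
    ; preserves = λ R xs (p , as , as∈ , r , e) →
        Structure.rel-resp A R (λ i → Structure.≈-sym A (_∼_.focus-≈ (e i))) r
    }

  module _ {A : Structure σ} where
    open Structure A using (_≈_; ≈-refl; ≈-sym; ≈-trans)

    ⦅_∣_⦆ : (P : Carrier A → Set ℓ) → (∀ {x y} → x ≈ y → P x → P y) → Subset A
    ⦅ P ∣ P-resp ⦆ = record
      { member      = λ x → ⌊ em {P x} ⌋
      ; member-resp = λ x≈y x∈ → fromWitness (P-resp x≈y (toWitness x∈))
      }

    support : ∀ {n} → Vector (Carrier A) n → Subset A
    support a = ⦅ (λ x → ∃[ i ] x ≈ a i)
                ∣ (λ x≈y (i , x≈a) → i , ≈-trans (≈-sym x≈y) x≈a) ⦆

    ∈-support : ∀ {n} (a : Vector (Carrier A) n) i → a i ∈ support a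
    ∈-support a i = fromWitness (i , ≈-refl)

    support-guarded : ∀ {n} (G : Guard σ 𝔤 n) (a : Vector (Carrier A) n) →
                      Satisfies A 𝔤 G a → GuardedSet A
    support-guarded G a sat = support a , (_ , G , a , sat , λ x x∈ → toWitness x∈)

    ∼-extend : ∀ {p : Play A} {U x y x∈ y∈} → x ≈ y → ⟨ p , x , x∈ ⟩ ∼ ⟨ p ▷ U , y , y∈ ⟩
    ∼-extend {p} {U} {x} {y} {x∈} {y∈} x≈y =
      common-prefix⇒∼ x≈y p (⊑-refl p) (append (⊑-refl p)) λ where
        u s (inj₁ t)          → at-p u s t
        u s (inj₂ (equal e))  → last-to x (≈ₚ-sym e) (Subset.member-resp (set U) (≈-sym x≈y) y∈)
        u s (inj₂ (append t)) → at-p u s t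
      where
      at-p : ∀ u → p ⊑ u → u ⊑ p → x ∈ last u
      at-p u s t = last-to x (⊑-antisym s t) x∈

  module _ {A B : Structure σ} (f : Hom (𝔾 A) B) where
    open Structure B using (_≈_; ≈-refl; ≈-sym; ≈-trans)
    open Hom f using (apply; apply-cong; preserves)
    private module A = Structure A

    -- For p = [U₁, …, Uⱼ], this is Vⱼ = { f [p , b] ∣ b ∈ Uⱼ }.

    image : Play A → Subset B
    image p = ⦅ (λ y → Σ[ b ∈ Carrier A ] Σ[ b∈ ∈ b ∈ last p ] y ≈ apply ⟨ p , b , b∈ ⟩)
              ∣ (λ x≈y (b , b∈ , e) → b , b∈ , ≈-trans (≈-sym x≈y) e) ⦆

    ∈-image : ∀ p {y} x x∈ → y ≈ apply ⟨ p , x , x∈ ⟩ → y ∈ image p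
    ∈-image p x x∈ e = fromWitness (x , x∈ , e)

    private
      transfer-at : ∀ {n} (α : Atom σ n) (a : Vector (Carrier A) n) (b : Vector (Carrier B) n)
                    (q : Play A) (a∈ : ∀ j → a (variableAt α j) ∈ last q) →
                    (∀ j → b (variableAt α j) ≈ apply ⟨ q , a (variableAt α j) , a∈ j ⟩) →
                    A ⊨ α [ a ] → B ⊨ α [ b ]
      transfer-at (rel R v) a b q a∈ e sat =
        Structure.rel-resp B R (λ i → ≈-sym (e i))
          (preserves R _ (q , a ∘ v , a∈ , sat , λ i → ∼-refl _))
      transfer-at (eq u w) a b q a∈ e sat =
        ≈-trans (e zero) (≈-trans (apply-cong (≈ₚ⇒∼ (≈ₚ-refl q) sat)) (≈-sym (e (suc zero))))

      transfer : ∀ {n} (α : Atom σ n) (a : Vector (Carrier A) n)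
                 (q : Play A) (a∈ : ∀ i → a i ∈ last q) →
                 A ⊨ α [ a ] → B ⊨ α [ (λ i → apply ⟨ q , a i , a∈ i ⟩) ]
      transfer α a q a∈ =
        transfer-at α a _ q (λ j → a∈ (variableAt α j)) (λ j → ≈-refl)

      singleton : ∀ 𝔥 → Σ[ G ∈ Guard σ 𝔥 1 ] ∀ x → Satisfies A 𝔥 G (λ _ → x)
      singleton atom   = (eq zero zero , λ { zero → zero , refl }) , λ x → A.≈-refl
      singleton loose  =
        (eq zero zero ∷ [] , λ { zero zero → here ((zero , refl) , (zero , refl)) }) ,
        λ x → A.≈-refl ∷ []
      singleton clique =
        ((0 , eq zero zero) ∷ [] , λ { zero zero → here ((zero , refl) , (zero , refl)) }) ,
        λ x → ((λ ()) , A.≈-refl) ∷ []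

      atom-as-clique : ∀ {n} (α : Atom σ n) (a : Vector (Carrier A) n) → A ⊨ α [ a ] →
                       Σ[ G ∈ Guard σ clique (positions α) ]
                         Satisfies A clique G (a ∘ variableAt α)
      atom-as-clique (rel R v) a sat =
        ((0 , rel R (_↑ˡ 0)) ∷ [] , λ i j → here ((i , refl) , (j , refl))) ,
        ((λ ()) , A.rel-resp R (λ i → reflexive (lookup-++ˡ (a ∘ v) (λ ()) i)) sat) ∷ []
        where
        reflexive : ∀ {x y} → x ≡ y → y A.≈ x
        reflexive refl = A.≈-refl
      atom-as-clique (eq u w) a sat =
        ((0 , eq zero (suc zero)) ∷ [] , λ i j → here ((occ i , occ j))) ,
        ((λ ()) , sat) ∷ []
        where
        occ : (i : Fin 2) → i ↑ˡ 0 occursIn eq {σ = σ} zero (suc zero)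
        occ zero       = zero , refl
        occ (suc zero) = suc zero , refl

      -- The elements of U need not exhaust the support of the guarding tuple a,
      -- so p is first extended with that support.

      transfer-guard : ∀ 𝔥 → 𝔥 ≡ 𝔤 → ∀ {n} (G : Guard σ 𝔥 n) (a : Vector (Carrier A) n)
                       (q : Play A) (a∈ : ∀ i → a i ∈ last q) → Satisfies A 𝔥 G a →
                       Satisfies B 𝔥 G (λ i → apply ⟨ q , a i , a∈ i ⟩)
      transfer-guard atom _ (α , _) a q a∈ sat = transfer α a q a∈ sat
      transfer-guard loose _ G a q a∈ sat = All.map (λ {α} → transfer α a q a∈) sat
      transfer-guard clique refl {n} G a q a∈ sat = All.map (λ {γ} → conjunct γ) sat
        where
        b : Vector (Carrier B) n
        b i = apply ⟨ q , a i , a∈ i ⟩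

        conjunct : ((k , α) : ∃[ k ] Atom σ (n + k)) →
                   Σ[ z ∈ Vector (Carrier A) k ] A ⊨ α [ a ++ z ] →
                   Σ[ z ∈ Vector (Carrier B) k ] B ⊨ α [ b ++ z ]
        conjunct (k , α) (z , s) = c , transfer-at α (a ++ z) (b ++ c) q′ occ∈ agree s
          where
          W : GuardedSet A
          W = support-guarded {A = A} (proj₁ (atom-as-clique α (a ++ z) s)) _
                              (proj₂ (atom-as-clique α (a ++ z) s))
          q′ : Play A
          q′ = q ▷ W
          occ∈ : ∀ j → (a ++ z) (variableAt α j) ∈ set W
          occ∈ = ∈-support {A = A} ((a ++ z) ∘ variableAt α)
          value : ∀ x → Dec (x ∈ set W) → Carrier B
          value x (yes x∈) = apply ⟨ q′ , x , x∈ ⟩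
          value x (no _)   = apply ⟨ [ support-guarded {A = A} (proj₁ (singleton 𝔤)) (λ _ → x)
                                         (proj₂ (singleton 𝔤) x) ]
                                   , x , ∈-support {A = A} {n = 1} (λ _ → x) zero ⟩
          c : Vector (Carrier B) k
          c w = value (z w) (T? _)
          value-agree : ∀ x d (x∈ : x ∈ set W) → value x d ≈ apply ⟨ q′ , x , x∈ ⟩
          value-agree x (yes _) x∈ = apply-cong (≈ₚ⇒∼ (≈ₚ-refl q′) A.≈-refl)
          value-agree x (no x∉) x∈ = ⊥-elim (x∉ x∈)
          agree-at : ∀ t (t∈ : (a ++ z) t ∈ set W) →
                     (b ++ c) t ≈ apply ⟨ q′ , (a ++ z) t , t∈ ⟩
          agree-at t t∈ with splitAt n t
          ... | inj₁ i = apply-cong (∼-extend A.≈-refl)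
          ... | inj₂ w = value-agree (z w) (T? _) t∈
          agree : ∀ j → (b ++ c) (variableAt α j) ≈ apply ⟨ q′ , (a ++ z) (variableAt α j) , occ∈ j ⟩
          agree j = agree-at (variableAt α j) (occ∈ j)

    image-guarded : ∀ p → IsGuarded A (last p) → IsGuarded B (image p)
    image-guarded p (n , G , a , sat , covers) =
      n , G , (λ i → apply ⟨ q , a i , ∈-support {A = A} a i ⟩) ,
      transfer-guard 𝔤 refl G a q (∈-support {A = A} a) sat ,
      λ y y∈ → let (x , x∈ , e) = toWitness y∈
                   (i , x≈a)    = covers x x∈
               in i , ≈-trans e (apply-cong (∼-extend x≈a))
      where
      q : Play A
      q = p ▷ support-guarded {A = A} G a sat

    coextend : Play A → Play B
    coextend [ U ]   = [ image [ U ] , image-guarded [ U ] (guarded U) ]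
    coextend (p ▷ U) = coextend p ▷ (image (p ▷ U) , image-guarded (p ▷ U) (guarded U))

    last-coextend : ∀ p {y} x x∈ → y ≈ apply ⟨ p , x , x∈ ⟩ → y ∈ last (coextend p)
    last-coextend [ U ]   = ∈-image [ U ]
    last-coextend (p ▷ U) = ∈-image (p ▷ U)

    private
      image-cong : ∀ {p q} → p ≈ₚ q → image p ≐ image q
      image-cong {p} {q} e y = mk⇔ (mono e) (mono (≈ₚ-sym e))
        where
        mono : ∀ {p q} → p ≈ₚ q → y ∈ image p → y ∈ image q
        mono {p} {q} e y∈ =
          let (x , x∈ , d) = toWitness y∈
          in ∈-image q x (last-to x e x∈) (≈-trans d (apply-cong (≈ₚ⇒∼ e A.≈-refl)))

      coextend-cong : ∀ {p q} → p ≈ₚ q → coextend p ≈ₚ coextend q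
      coextend-cong [ e ]   = [ image-cong [ e ] ]
      coextend-cong (d ▷ e) = coextend-cong d ▷ image-cong (d ▷ e)

      coextend-mono : ∀ {p q} → p ⊑ q → coextend p ⊑ coextend q
      coextend-mono (equal e)  = equal (coextend-cong e)
      coextend-mono (append s) = append (coextend-mono s)

      lift-between : ∀ {c p u} → c ⊑ p → coextend c ⊑ u → u ⊑ coextend p →
                     ∃[ v ] (c ⊑ v × v ⊑ p × u ≈ₚ coextend v)
      lift-between {c} (equal e) s t =
        c , ⊑-refl c , equal e ,
        ⊑-antisym (⊑-≈ₚ t (≈ₚ-sym (coextend-cong e))) s
      lift-between (append {U = U} r) s (equal e) = _ , append r , ⊑-refl _ , e
      lift-between (append r) s (append t) =
        let (v , c⊑v , v⊑p , e) = lift-between r s t in v , c⊑v , append v⊑p , e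

    coextend-focussed : FocussedPlay A → FocussedPlay B
    coextend-focussed ⟨ p , a , a∈ ⟩ =
      ⟨ coextend p , apply ⟨ p , a , a∈ ⟩ , last-coextend p a a∈ ≈-refl ⟩

    coextend-focussed-cong : ∀ {x y} → x ∼ y → coextend-focussed x ∼ coextend-focussed y
    coextend-focussed-cong {x@(⟨ p , a , a∈ ⟩)} {y@(⟨ q , a′ , a′∈ ⟩)} d =
      common-prefix⇒∼ (apply-cong d) (coextend p⊓q)
        (coextend-mono prefixˡ) (coextend-mono prefixʳ) λ where
          u s (inj₁ t) → let (v , c⊑v , v⊑p , e) = lift-between prefixˡ s t
                         in last-to _ (≈ₚ-sym e) (∈-last v c⊑v (inj₁ v⊑p))
          u s (inj₂ t) → let (v , c⊑v , v⊑q , e) = lift-between prefixʳ s t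
                         in last-to _ (≈ₚ-sym e) (∈-last v c⊑v (inj₂ v⊑q))
      where
      open _∼_ d
      open _IsGCPof_,_ isGCP
      shorten : ∀ {x p v} (v∈ : FocussedPlay.focus x ∈ last v) → FocussedPlay.play x ≡ p →
                v ⊑ p → (∀ w → v ⊑ w → w ⊑ p → FocussedPlay.focus x ∈ last w) →
                x ∼ ⟨ v , FocussedPlay.focus x , v∈ ⟩
      shorten {v = v} v∈ refl v⊑p w∈ =
        common-prefix⇒∼ A.≈-refl v v⊑p (⊑-refl v) λ where
          w v⊑w (inj₁ w⊑p) → w∈ w v⊑w w⊑p
          w v⊑w (inj₂ w⊑v) → w∈ w v⊑w (⊑-trans w⊑v v⊑p)
      to-y : ∀ u → a ∈ last u → a′ ∈ last u
      to-y u = Subset.member-resp (last u) focus-≈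
      ∈-last : ∀ v → p⊓q ⊑ v → v ⊑ p ⊎ v ⊑ q → apply x ∈ last (coextend v)
      ∈-last v c⊑v (inj₁ v⊑p) =
        last-coextend v a (within v c⊑v (inj₁ v⊑p))
          (apply-cong (shorten _ refl v⊑p
            (λ w v⊑w w⊑p → within w (⊑-trans c⊑v v⊑w) (inj₁ w⊑p))))
      ∈-last v c⊑v (inj₂ v⊑q) =
        last-coextend v a′ (to-y v (within v c⊑v (inj₂ v⊑q)))
          (≈-trans (apply-cong d) (apply-cong (shorten _ refl v⊑q
            (λ w v⊑w w⊑q → to-y w (within w (⊑-trans c⊑v v⊑w) (inj₂ w⊑q))))))

  infix 10 _*
  _* : {A B : Structure σ} → Hom (𝔾 A) B → Hom (𝔾 A) (𝔾 B)
  f * = record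
    { func      = record { to = coextend-focussed f ; cong = coextend-focussed-cong f }
    ; preserves = λ R xs r@(p , as , as∈ , _ , e) →
        let fp i = coextend-focussed f ⟨ p , as i , as∈ i ⟩
        in coextend f p , FocussedPlay.focus ∘ fp , FocussedPlay.focus∈ ∘ fp ,
           Hom.preserves f R _ (p , as , as∈ , proj₁ (proj₂ (proj₂ (proj₂ r))) , λ i → ∼-refl _) ,
           λ i → coextend-focussed-cong f (e i)
    }

  module _ {A B : Structure σ} where
    private
      image-mono-≋ : (f g : Hom (𝔾 A) B) → f ≋ g →
                     ∀ p y → y ∈ image f p → y ∈ image g p
      image-mono-≋ f g f≋g p y y∈ =
        let (b , b∈ , e) = toWitness y∈
        in ∈-image g p b b∈ (Structure.≈-trans B e (f≋g _))

      image-resp-≋ : (f g : Hom (𝔾 A) B) → f ≋ g → ∀ p → image f p ≐ image g p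
      image-resp-≋ f g f≋g p y =
        mk⇔ (image-mono-≋ f g f≋g p y)
            (image-mono-≋ g f (λ x → Structure.≈-sym B (f≋g x)) p y)

      coextend-resp-≋ : (f g : Hom (𝔾 A) B) → f ≋ g → ∀ p → coextend f p ≈ₚ coextend g p
      coextend-resp-≋ f g f≋g [ U ]   = [ image-resp-≋ f g f≋g [ U ] ]
      coextend-resp-≋ f g f≋g (p ▷ U) =
        coextend-resp-≋ f g f≋g p ▷ image-resp-≋ f g f≋g (p ▷ U)

    -- Coextension is an operation on morphisms up to _≋_, which plays the role
    -- of equality of morphisms.

    *-resp-≋ : (f g : Hom (𝔾 A) B) → f ≋ g → f * ≋ g *
    *-resp-≋ f g f≋g x = ≈ₚ⇒∼ (coextend-resp-≋ f g f≋g (FocussedPlay.play x)) (f≋g x)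

{-# OPTIONS --safe #-}
module Submission where

open import Defs
open import Axiom.ExcludedMiddle using (ExcludedMiddle)
open import Data.Product.Base using (Σ-syntax; _×_; _,_)
open import Function.Bundles using (mk⇔; Equivalence)
open import Relation.Nullary.Decidable using (toWitness)

-- The last set of a coextended play [U₁, …, Uₙ] is Vₙ = { f [p , b] ∣ b ∈ Uₙ },
-- so the laws for plays reduce, by induction, to a comparison of images: the
-- counit sends Uₙ to itself, and images compose. On focuses the laws hold on
-- the nose.

module _ {ℓ} (em : ExcludedMiddle ℓ) (σ : Vocabulary ℓ) (𝔤 : Guarding) where
  open GuardedComonad em σ 𝔤
  open Structure using (Carrier)

  image⁻ : ∀ {A B : Structure σ} (f : Hom (𝔾 A) B) (p : Play A) {y} → y ∈ image f p →
           Σ[ x ∈ Carrier A ] Σ[ x∈ ∈ x ∈ last p ]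
             Structure._≈_ B y (Hom.apply f ⟨ p , x , x∈ ⟩)
  image⁻ f p y∈ = toWitness y∈

  -- Both sides unfold to the same set, but `coextend` reduces only once `p` is a constructor, hence
  -- the case split.
  last-coextend-image : ∀ {A B : Structure σ} (f : Hom (𝔾 A) B) (p : Play A) →
                        last (coextend f p) ≐ image f p
  last-coextend-image f [ U ]   = ≐-refl (image f [ U ])
  last-coextend-image f (p ▷ U) = ≐-refl (image f (p ▷ U))

  image-ε : ∀ {A : Structure σ} (p : Play A) → image (ε A) p ≐ last p
  image-ε {A} p y = mk⇔
    (λ y∈ → let (x , x∈ , y≈x) = image⁻ (ε A) p y∈
            in Subset.member-resp (last p) (Structure.≈-sym A y≈x) x∈)
    (λ y∈ → ∈-image (ε A) p y y∈ (Structure.≈-refl A))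

  -- `≈ₚ` compares only the sets of a play, so the two guardedness witnesses need not agree.
  coextend-ε : ∀ {A : Structure σ} (p : Play A) → coextend (ε A) p ≈ₚ p
  coextend-ε [ U ]   = [ image-ε [ U ] ]
  coextend-ε (p ▷ U) = coextend-ε p ▷ image-ε (p ▷ U)

  module _ {A B C : Structure σ} (f : Hom (𝔾 A) B) (g : Hom (𝔾 B) C) where
    open Structure using (≈-trans)

    image-∘ : ∀ p → image (g ∘ₕ f *) p ≐ image g (coextend f p)
    image-∘ p y = mk⇔ to from
      where
      to : y ∈ image (g ∘ₕ f *) p → y ∈ image g (coextend f p)
      to y∈ = let (x , x∈ , y≈) = image⁻ (g ∘ₕ f *) p y∈
              -- The holes are the value of `f` at `⟨ p , x , x∈ ⟩` and its membership, read off
              -- from the type of `y≈`.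
              in ∈-image g (coextend f p) _ _ y≈

      from : y ∈ image g (coextend f p) → y ∈ image (g ∘ₕ f *) p
      from y∈ =
        let (z , z∈ , y≈) = image⁻ g (coextend f p) y∈
            (x , x∈ , z≈) = image⁻ f p (Equivalence.to (last-coextend-image f p z) z∈)
        in ∈-image (g ∘ₕ f *) p x x∈
             -- `z` is a value of `f` only up to `≈`; the two focussed plays share their play, so
             -- they are `∼`-related and `g` identifies them.
             (≈-trans C y≈ (Hom.apply-cong g (≈ₚ⇒∼ (≈ₚ-refl (coextend f p)) z≈)))

    coextend-∘ : ∀ p → coextend (g ∘ₕ f *) p ≈ₚ coextend g (coextend f p)
    coextend-∘ [ U ]   = [ image-∘ [ U ] ]
    coextend-∘ (p ▷ U) = coextend-∘ p ▷ image-∘ (p ▷ U)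

theorem3p5 : ∀ {ℓ} (em : ExcludedMiddle ℓ) (σ : Vocabulary ℓ) (𝔤 : Guarding) →
    let open GuardedComonad em σ 𝔤 in
    (∀ (A : Structure σ) → ε A * ≋ idₕ (𝔾 A))
    × (∀ (A B : Structure σ) (f : Hom (𝔾 A) B) → ε B ∘ₕ f * ≋ f)
    × (∀ (A B C : Structure σ) (f : Hom (𝔾 A) B) (g : Hom (𝔾 B) C) →
    (g ∘ₕ f *) * ≋ g * ∘ₕ f *)
theorem3p5 em σ 𝔤 =
    (λ A x → ≈ₚ⇒∼ (coextend-ε em σ 𝔤 (FocussedPlay.play x)) (≈-refl A))
  -- The focus of `f *` at `x` is by definition the value of `f` at `x`.
  , (λ A B f x → ≈-refl B)
  , (λ A B C f g x → ≈ₚ⇒∼ (coextend-∘ em σ 𝔤 f g (FocussedPlay.play x)) (≈-refl C))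
  where
  open GuardedComonad em σ 𝔤
  open Structure using (≈-refl)
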